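{- Let $q$ be a prime power, let $F$ be a field containing $\mathbb{F}_q$, let $d\ge 1$ and $1\le s\le q$ be integers, let $b_1,\dots,b_d\in F$ be linearly independent over $\mathbb{F}_q$, and let $B_{ij}\in F$ for $1\le i\le d$, $1\le j\le s$. Then $$\prod_{j=1}^s\ \sum_{\theta\in \mathbb{F}_q^d\setminus\{0\}}\frac{\sum_{i=1}^d\theta_iB_{ij}}{\sum_{i=1}^d \theta_ib_i} =(-1)^{s-1} \sum_{\theta\in \mathbb{F}_q^d\setminus\{0\}} \frac{\prod_{j=1}^s \big(\sum_{i=1}^d \theta_iB_{ij}\big)}{\big(\sum_{i=1}^d \theta_ib_i\big)^s},$$ where $\theta=(\theta_1,\dots,\theta_d)$. -}

module Defs where

open import Level using (Level; _⊔_)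
open import Data.Nat as ℕ using (ℕ; zero; suc; _∸_)
open import Data.Fin using (Fin; zero; suc)
open import Data.Product using (∃; Σ; _×_; _,_)
open import Relation.Nullary using (¬_)
open import Relation.Binary.PropositionalEquality using (_≡_)
open import Algebra.Bundles using (CommutativeRing)

-- A field: a commutative ring with 0 ≠ 1 in which every nonzero element
-- has a multiplicative inverse.  The inverse is given as a total function
-- _⁻¹ whose value at 0# is unspecified (only used at nonzero elements).
record Field (c ℓ : Level) : Set (Level.suc (c ⊔ ℓ)) where
  field
    commutativeRing : CommutativeRing c ℓ
  open CommutativeRing commutativeRing public hiding (zero)
  field
    _⁻¹       : Carrier → Carrier
    0≉1       : ¬ (0# ≈ 1#)
    ⁻¹-inverse : ∀ x → ¬ (x ≈ 0#) → (x * (x ⁻¹)) ≈ 1#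

  infixl 7 _/_
  _/_ : Carrier → Carrier → Carrier
  x / y = x * (y ⁻¹)

  ∑ : (n : ℕ) → (Fin n → Carrier) → Carrier
  ∑ zero    f = 0#
  ∑ (suc n) f = f zero + ∑ n (λ i → f (suc i))

  ∏ : (n : ℕ) → (Fin n → Carrier) → Carrier
  ∏ zero    f = 1#
  ∏ (suc n) f = f zero * ∏ n (λ i → f (suc i))

  _^_ : Carrier → ℕ → Carrier
  x ^ zero  = 1#
  x ^ suc n = x * (x ^ n)

record FiniteSubfield {c ℓ} (F : Field c ℓ) (q : ℕ) : Set (c ⊔ ℓ) where
  open Field F hiding (_^_)
  field
    e        : Fin q → Carrier
    e-inj    : ∀ i j → e i ≈ e j → i ≡ j
    zeroIdx  : Fin q
    e-zero   : e zeroIdx ≈ 0#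
    oneIdx   : Fin q
    e-one    : e oneIdx ≈ 1#
    +-closed : ∀ i j → ∃ λ k → e k ≈ (e i + e j)
    *-closed : ∀ i j → ∃ λ k → e k ≈ (e i * e j)
    neg-closed : ∀ i → ∃ λ k → e k ≈ (- e i)
    inv-closed : ∀ i → ¬ (e i ≈ 0#) → ∃ λ k → e k ≈ (e i ⁻¹)

open import Data.Nat.Primality using (Prime)
IsPrimePower : ℕ → Set
IsPrimePower q = ∃ λ p → ∃ λ k → Prime p × (q ≡ p ℕ.^ suc k)

module FqVectors {c ℓ} (F : Field c ℓ) {q : ℕ} (K : FiniteSubfield F q) where
  open Field F
  open FiniteSubfield K

  -- vectors θ ∈ F_q^d, represented by indices into the enumeration
  Vecq : ℕ → Set
  Vecq d = Fin d → Fin q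

  open import Data.Fin using (_≟_)
  open import Relation.Nullary using (yes; no)

  ∑all : (d : ℕ) → ((Fin d → Fin q) → Carrier) → Carrier
  ∑all zero    g = g (λ ())
  ∑all (suc d) g = ∑ q (λ a → ∑all d (λ θ → g (ext a θ)))
    where
      ext : Fin q → (Fin d → Fin q) → (Fin (suc d) → Fin q)
      ext a θ zero    = a
      ext a θ (suc i) = θ i

  ∑nz : (d : ℕ) → ((Fin d → Fin q) → Carrier) → Carrier
  ∑nz zero    g = 0#
  ∑nz (suc d) g = ∑ q (λ a → h a)
    where
      extend : Fin q → (Fin d → Fin q) → (Fin (suc d) → Fin q)
      extend a θ zero    = a
      extend a θ (suc i) = θ i
      h : Fin q → Carrier
      h a with a ≟ zeroIdx
      ... | yes _ = ∑nz d (λ θ → g (extend a θ))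
      ... | no  _ = ∑all d (λ θ → g (extend a θ))

  LinIndep : (d : ℕ) → (Fin d → Carrier) → Set ℓ
  LinIndep d b = ∀ (θ : Fin d → Fin q) →
    ∑ d (λ i → e (θ i) * b i) ≈ 0# → ∀ i → θ i ≡ zeroIdx

-- Write M n g = ∑_v g(v) / D(v)ⁿ over nonzero v ∈ F_q^d, where D = ∑ θᵢbᵢ.
-- By induction on s it suffices that M s P · M 1 ψ = - M (s+1) (Pψ) when ψ is
-- linear and P is a product of s < q linear forms.  Terms that are not
-- homogeneous of degree 0 mod q - 1 sum to zero, so the left side equals
-- ∑_{u,v} P(u) ψ(v) ∑_{a+b=s+1; a,b≥1} D(u)⁻ᵃ D(v)⁻ᵇ.  Writing ψ(v) = ψ(u) - ψ(w) with
-- u = v + w, the inner sum is geometric and collapses to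
-- D(w)⁻¹ (D(v)⁻ˢ - D(u)⁻ˢ).  In the resulting sum over v and w, averaging P(v + w)
-- over the F_q-multiples of w leaves only terms that cancel, and the correction
-- at v = 0 contributes - M (s+1) (Pψ).

module Submission where

open import Defs
open import Level using (Level; _⊔_)
open import Algebra.Bundles using (CommutativeRing; RawRing)
open import Algebra.Solver.Ring.AlmostCommutativeRing using
  (fromCommutativeRing; _-Raw-AlmostCommutative⟶_)
open import Data.Empty using (⊥-elim)
open import Data.Fin using (Fin; zero; suc; _≟_; inject≤)
open import Data.Fin.Permutation using (Permutation′; permutation; _⟨$⟩ʳ_)
open import Data.Fin.Properties using (¬∀⟶∃¬; inject≤-injective; 0≢1+n; suc-injective)
open import Data.Maybe using (Maybe; just; nothing)
open import Data.Nat as ℕ using (ℕ; zero; suc; _≤_; _<_; _∸_; z≤n; s≤s)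
import Data.Nat.Properties as ℕₚ
open import Data.Product using (∃; _×_; _,_; proj₁; proj₂)
open import Data.Sum using (_⊎_; inj₁; inj₂; [_,_]′)
open import Data.Vec using (Vec; []; _∷_; lookup; map; zipWith; replicate)
open import Data.Vec.Properties using
  (lookup-zipWith; lookup-map; lookup-replicate; map-replicate; zipWith-comm; zipWith-identityˡ; ∷-injectiveˡ; ∷-injectiveʳ)
  renaming (≡-dec to Vec-≡-dec)
open import Function using (_∘_)
open import Relation.Binary.PropositionalEquality as ≡ using (_≡_; _≢_)
open import Relation.Nullary using (¬_; Dec; yes; no)
open import Relation.Nullary.Decidable using (map′)

-- A ring solver for arbitrary commutative rings: the coefficient (m , n)
-- stands for the integer m - n, so that cancellations are decided in ℕ.
module IntegerCoefficients {c ℓ} (R : CommutativeRing c ℓ) where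
  open CommutativeRing R hiding (zero)
  open import Algebra.Properties.Semiring.Mult semiring using (×-homo-+; ×1-homo-*)
    renaming (_×_ to _·_)
  open import Algebra.Properties.Ring ring
  open import Algebra.Properties.CommutativeSemigroup +-commutativeSemigroup using (interchange)
  open import Relation.Binary.Reasoning.Setoid setoid

  private
    ι : ℕ → Carrier
    ι n = n · 1#

    coefficients : RawRing _ _
    coefficients = record
      { Carrier = ℕ × ℕ
      ; _≈_     = _≡_
      ; _+_     = λ (a , b) (c , d) → a ℕ.+ c , b ℕ.+ d
      ; _*_     = λ (a , b) (c , d) → a ℕ.* c ℕ.+ b ℕ.* d , a ℕ.* d ℕ.+ b ℕ.* c
      ; -_      = λ (a , b) → b , a
      ; 0#      = 0 , 0
      ; 1#      = 1 , 0
      }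

    ⟦_⟧ : ℕ × ℕ → Carrier
    ⟦ a , b ⟧ = ι a - ι b

    ι-+ : ∀ m n → ι (m ℕ.+ n) ≈ ι m + ι n
    ι-+ = ×-homo-+ 1#

    ι-sum-of-products : ∀ a b c d → ι (a ℕ.* c ℕ.+ b ℕ.* d) ≈ ι a * ι c + ι b * ι d
    ι-sum-of-products a b c d =
      trans (ι-+ (a ℕ.* c) (b ℕ.* d)) (+-cong (×1-homo-* a c) (×1-homo-* b d))

    neg-+ : ∀ x y → - (x + y) ≈ - x - y
    neg-+ x y = sym (-‿+-comm x y)

    +-homo : ∀ p p′ → ⟦ proj₁ p ℕ.+ proj₁ p′ , proj₂ p ℕ.+ proj₂ p′ ⟧ ≈ ⟦ p ⟧ + ⟦ p′ ⟧
    +-homo (a , b) (c , d) = begin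
      ι (a ℕ.+ c) - ι (b ℕ.+ d)      ≈⟨ +-cong (ι-+ a c) (trans (-‿cong (ι-+ b d)) (neg-+ _ _)) ⟩
      (ι a + ι c) + (- ι b - ι d)    ≈⟨ interchange _ _ _ _ ⟩
      (ι a - ι b) + (ι c - ι d)      ∎

    *-homo : ∀ p p′ → ⟦ RawRing._*_ coefficients p p′ ⟧ ≈ ⟦ p ⟧ * ⟦ p′ ⟧
    *-homo (a , b) (c , d) = begin
      ι (a ℕ.* c ℕ.+ b ℕ.* d) - ι (a ℕ.* d ℕ.+ b ℕ.* c)
        ≈⟨ +-cong (ι-sum-of-products a b c d) (trans (-‿cong (ι-sum-of-products a b d c)) (neg-+ _ _)) ⟩
      (ι a * ι c + ι b * ι d) + (- (ι a * ι d) - ι b * ι c)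
        ≈⟨ +-congˡ (+-comm _ _) ⟩
      (ι a * ι c + ι b * ι d) + (- (ι b * ι c) - ι a * ι d)
        ≈⟨ interchange _ _ _ _ ⟩
      (ι a * ι c - ι b * ι c) + (ι b * ι d - ι a * ι d)
        ≈⟨ +-cong ([y-z]x≈yx-zx _ _ _) flip ⟨
      (ι a - ι b) * ι c + (ι a - ι b) * (- ι d)
        ≈⟨ distribˡ _ _ _ ⟨
      (ι a - ι b) * (ι c - ι d) ∎
      where
      flip : (ι a - ι b) * (- ι d) ≈ ι b * ι d - ι a * ι d
      flip = begin
        (ι a - ι b) * (- ι d)          ≈⟨ -‿distribʳ-* _ _ ⟨
        - ((ι a - ι b) * ι d)          ≈⟨ -‿cong ([y-z]x≈yx-zx _ _ _) ⟩
        - (ι a * ι d - ι b * ι d)      ≈⟨ neg-+ _ _ ⟩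
        - (ι a * ι d) - - (ι b * ι d)  ≈⟨ +-congˡ (-‿involutive _) ⟩
        - (ι a * ι d) + ι b * ι d      ≈⟨ +-comm _ _ ⟩
        ι b * ι d - ι a * ι d          ∎

    -‿homo : ∀ p → ⟦ proj₂ p , proj₁ p ⟧ ≈ - ⟦ p ⟧
    -‿homo (a , b) = sym (begin
      - (ι a - ι b)      ≈⟨ neg-+ _ _ ⟩
      - ι a - - ι b      ≈⟨ +-congˡ (-‿involutive _) ⟩
      - ι a + ι b        ≈⟨ +-comm _ _ ⟩
      ι b - ι a          ∎)

    morphism : coefficients -Raw-AlmostCommutative⟶ fromCommutativeRing R
    morphism = record
      { ⟦_⟧    = ⟦_⟧
      ; +-homo = +-homo
      ; *-homo = *-homo
      ; -‿homo = -‿homo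
      ; 0-homo = -‿inverseʳ 0#
      ; 1-homo = trans (+-congˡ -0#≈0#) (trans (+-identityʳ _) (+-identityʳ 1#))
      }

    ⟦⟧-cong : ∀ a b c d → a ℕ.+ d ≡ c ℕ.+ b → ⟦ a , b ⟧ ≈ ⟦ c , d ⟧
    ⟦⟧-cong a b c d eq = begin
      ι a - ι b                  ≈⟨ +-identityʳ _ ⟨
      (ι a - ι b) + 0#           ≈⟨ +-congˡ (-‿inverseʳ (ι d)) ⟨
      (ι a - ι b) + (ι d - ι d)  ≈⟨ interchange _ _ _ _ ⟩
      (ι a + ι d) + (- ι b - ι d) ≈⟨ +-cong move (+-comm _ _) ⟩
      (ι c + ι b) + (- ι d - ι b) ≈⟨ interchange _ _ _ _ ⟩
      (ι c - ι d) + (ι b - ι b)  ≈⟨ +-congˡ (-‿inverseʳ (ι b)) ⟩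
      (ι c - ι d) + 0#           ≈⟨ +-identityʳ _ ⟩
      ι c - ι d                  ∎
      where
      move : ι a + ι d ≈ ι c + ι b
      move = trans (sym (ι-+ a d)) (trans (reflexive (≡.cong ι eq)) (ι-+ c b))

    _coeff≟_ : ∀ p p′ → Maybe (⟦ p ⟧ ≈ ⟦ p′ ⟧)
    (a , b) coeff≟ (c , d) with a ℕ.+ d ℕ.≟ c ℕ.+ b
    ... | yes eq = just (⟦⟧-cong a b c d eq)
    ... | no  _  = nothing

  open import Algebra.Solver.Ring coefficients (fromCommutativeRing R) morphism _coeff≟_ public
    using (solve; _:=_; _:+_; _:*_; _:-_; :-_)

-- Cancellation, powers, roots of polynomials and finite sums in a field.

module FieldProperties {c ℓ} (F : Field c ℓ) where
  open Field F
  open IntegerCoefficients commutativeRing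
  open import Algebra.Properties.Ring ring using (-0#≈0#; -1*x≈-x)
  open import Algebra.Properties.Group +-group using (x∙y⁻¹≈ε⇒x≈y)
  open import Algebra.Properties.CommutativeMonoid.Sum +-commutativeMonoid using (sum; sum-permute)
  open import Relation.Binary.Reasoning.Setoid setoid

  x-y≈0⇒x≈y : ∀ x y → x - y ≈ 0# → x ≈ y
  x-y≈0⇒x≈y = x∙y⁻¹≈ε⇒x≈y

  *-cancelˡ-≉0 : ∀ {x y z} → ¬ x ≈ 0# → x * y ≈ x * z → y ≈ z
  *-cancelˡ-≉0 {x} {y} {z} x≉0 xy≈xz = begin
    y               ≈⟨ *-identityˡ y ⟨
    1# * y          ≈⟨ *-congʳ (⁻¹-inverse x x≉0) ⟨
    x * x ⁻¹ * y    ≈⟨ solve 3 (λ a b c → a :* b :* c := b :* (a :* c)) refl _ _ _ ⟩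
    x ⁻¹ * (x * y)  ≈⟨ *-congˡ xy≈xz ⟩
    x ⁻¹ * (x * z)  ≈⟨ solve 3 (λ a b c → a :* b :* c := b :* (a :* c)) refl _ _ _ ⟨
    x * x ⁻¹ * z    ≈⟨ *-congʳ (⁻¹-inverse x x≉0) ⟩
    1# * z          ≈⟨ *-identityˡ z ⟩
    z               ∎

  x*y≈0⇒y≈0 : ∀ {x y} → ¬ x ≈ 0# → x * y ≈ 0# → y ≈ 0#
  x*y≈0⇒y≈0 x≉0 xy≈0 = *-cancelˡ-≉0 x≉0 (trans xy≈0 (sym (zeroʳ _)))

  x*y≈1⇒x≉0 : ∀ {x y} → x * y ≈ 1# → ¬ x ≈ 0#
  x*y≈1⇒x≉0 xy≈1 x≈0 = 0≉1 (trans (sym (trans (*-congʳ x≈0) (zeroˡ _))) xy≈1)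

  -- `x` is nonzero because its product with `y` is 1, so it can be cancelled. `Field` does not
  -- postulate that `_⁻¹` respects `≈`; this lemma is what allows inverses of equal elements to be
  -- compared.
  ⁻¹-unique : ∀ {x y} → x * y ≈ 1# → y ≈ x ⁻¹
  ⁻¹-unique xy≈1 = *-cancelˡ-≉0 x≉0 (trans xy≈1 (sym (⁻¹-inverse _ x≉0)))
    where x≉0 = x*y≈1⇒x≉0 xy≈1

  ^-cong : ∀ {x y} n → x ≈ y → x ^ n ≈ y ^ n
  ^-cong zero    x≈y = refl
  ^-cong (suc n) x≈y = *-cong x≈y (^-cong n x≈y)

  1^n≈1 : ∀ n → 1# ^ n ≈ 1#
  1^n≈1 zero    = refl
  1^n≈1 (suc n) = trans (*-identityˡ _) (1^n≈1 n)

  ^-distrib-* : ∀ x y n → (x * y) ^ n ≈ x ^ n * y ^ n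
  ^-distrib-* x y zero    = sym (*-identityˡ 1#)
  ^-distrib-* x y (suc n) = trans (*-congˡ (^-distrib-* x y n))
    (solve 4 (λ x y a b → x :* y :* (a :* b) := x :* a :* (y :* b)) refl x y (x ^ n) (y ^ n))

  ^-homo-+ : ∀ x m n → x ^ (m ℕ.+ n) ≈ x ^ m * x ^ n
  ^-homo-+ x zero    n = sym (*-identityˡ _)
  ^-homo-+ x (suc m) n = trans (*-congˡ (^-homo-+ x m n)) (sym (*-assoc _ _ _))

  0^n≈0 : ∀ {x n} → 1 ≤ n → x ≈ 0# → x ^ n ≈ 0#
  0^n≈0 {n = suc n} _ x≈0 = trans (*-congʳ x≈0) (zeroˡ _)

  module Horner where
    -- A vector of length `k` holds the lower coefficients of a monic polynomial of degree `k`,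
    -- constant term first. The leading 1 is the value at `[]`.
    eval : ∀ {k} → Vec Carrier k → Carrier → Carrier
    eval []       x = 1#
    eval (c ∷ cs) x = c + x * eval cs x

    -- Synthetic division by x - y: the coefficients are the values at `y` of the successive tails,
    -- and the result is again monic, of degree one less.
    quotient : ∀ {k} → Vec Carrier (suc k) → Carrier → Vec Carrier k
    quotient (_ ∷ [])      y = []
    quotient (_ ∷ c ∷ cs) y = eval (c ∷ cs) y ∷ quotient (c ∷ cs) y

    factor : ∀ {k} (f : Vec Carrier (suc k)) x y →
      eval f x - eval f y ≈ (x - y) * eval (quotient f y) x
    factor (c ∷ []) x y =
      solve 4 (λ c x y o → c :+ x :* o :- (c :+ y :* o) := (x :- y) :* o) refl c x y 1#
    factor (c ∷ g@(_ ∷ _)) x y = begin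
      c + x * eval g x - (c + y * eval g y)
        ≈⟨ solve 5 (λ c x y a b → c :+ x :* a :- (c :+ y :* b) := (x :- y) :* b :+ x :* (a :- b))
             refl c x y (eval g x) (eval g y) ⟩
      (x - y) * eval g y + x * (eval g x - eval g y)
        ≈⟨ +-congˡ (*-congˡ (factor g x y)) ⟩
      (x - y) * eval g y + x * ((x - y) * eval (quotient g y) x)
        ≈⟨ solve 4 (λ d b x a → d :* b :+ x :* (d :* a) := d :* (b :+ x :* a))
             refl (x - y) (eval g y) x (eval (quotient g y) x) ⟩
      (x - y) * (eval g y + x * eval (quotient g y) x) ∎

    -- Dividing out the root `r zero` leaves a monic polynomial of smaller degree that vanishes at
    -- the remaining points, since these differ from `r zero`. In degree 0 the polynomial is 1 and
    -- has no root.
    too-many-roots : ∀ k (f : Vec Carrier k) (r : Fin (suc k) → Carrier) →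
      (∀ i j → r i ≈ r j → i ≡ j) → ¬ (∀ i → eval f (r i) ≈ 0#)
    too-many-roots zero    []  r r-inj root = 0≉1 (sym (root zero))
    too-many-roots (suc k) f r r-inj root =
      too-many-roots k (quotient f (r zero)) (r ∘ suc)
        (λ i j eq → suc-injective (r-inj (suc i) (suc j) eq))
        λ i → x*y≈0⇒y≈0
          (λ eq → 0≢1+n (≡.sym (r-inj (suc i) zero (x-y≈0⇒x≈y _ _ eq))))
          (trans (sym (factor f _ _))
            (trans (+-cong (root (suc i)) (-‿cong (root zero))) (-‿inverseʳ 0#)))

    eval-x^[2+n]-x : ∀ n x → eval (0# ∷ - 1# ∷ replicate n 0#) x ≈ x ^ suc (suc n) - x
    eval-x^[2+n]-x n x = begin
      0# + x * (- 1# + x * eval (replicate n 0#) x)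
        ≈⟨ trans (+-identityˡ _) (*-congˡ (+-congˡ (*-congˡ (monomial n)))) ⟩
      x * (- 1# + x * x ^ n)
        ≈⟨ solve 3 (λ x o a → x :* (:- o :+ x :* a) := x :* (x :* a) :- x :* o) refl x 1# (x ^ n) ⟩
      x * (x * x ^ n) - x * 1#
        ≈⟨ +-congˡ (-‿cong (*-identityʳ x)) ⟩
      x ^ suc (suc n) - x ∎
      where
      monomial : ∀ n → eval (replicate n 0#) x ≈ x ^ n
      monomial zero    = refl
      monomial (suc n) = trans (+-identityˡ _) (*-congˡ (monomial n))

  -- Linear functionals on functions: the common interface of sums over `Fin n` and sums over
  -- vectors, so that linearity and exchange of sums are proved once for both.
  record Summation {X : Set} (A : (X → Carrier) → Carrier) : Set (c ⊔ ℓ) where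
    field
      cong     : ∀ {f g} → (∀ x → f x ≈ g x) → A f ≈ A g
      +-homo   : ∀ f g → A (λ x → f x + g x) ≈ A f + A g
      *-homoˡ  : ∀ k f → A (λ x → k * f x) ≈ k * A f

    *-homoʳ : ∀ k f → A (λ x → f x * k) ≈ A f * k
    *-homoʳ k f = trans (cong λ x → *-comm (f x) k) (trans (*-homoˡ k f) (*-comm k _))

    0-homo : ∀ {f} → (∀ x → f x ≈ 0#) → A f ≈ 0#
    0-homo {f} f≈0 = begin
      A f                  ≈⟨ cong (λ x → trans (f≈0 x) (sym (zeroˡ 0#))) ⟩
      A (λ _ → 0# * 0#)    ≈⟨ *-homoˡ 0# _ ⟩
      0# * A (λ _ → 0#)    ≈⟨ zeroˡ _ ⟩
      0#                   ∎

    neg-homo : ∀ f → A (λ x → - f x) ≈ - A f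
    neg-homo f = begin
      A (λ x → - f x)       ≈⟨ cong (λ x → -1*x≈-x (f x)) ⟨
      A (λ x → - 1# * f x)  ≈⟨ *-homoˡ _ _ ⟩
      - 1# * A f            ≈⟨ -1*x≈-x _ ⟩
      - A f                 ∎

    sub-homo : ∀ f g → A (λ x → f x - g x) ≈ A f - A g
    sub-homo f g = trans (+-homo f (λ x → - g x)) (+-congˡ (neg-homo g))

  Summation-∑ : ∀ n → Summation (∑ n)
  Summation-∑ n = record { cong = cong n ; +-homo = homo n ; *-homoˡ = scale n }
    where
    cong : ∀ n {f g} → (∀ x → f x ≈ g x) → ∑ n f ≈ ∑ n g
    cong zero    eq = refl
    cong (suc n) eq = +-cong (eq zero) (cong n (eq ∘ suc))
    homo : ∀ n f g → ∑ n (λ x → f x + g x) ≈ ∑ n f + ∑ n g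
    homo zero    f g = sym (+-identityˡ 0#)
    homo (suc n) f g = trans (+-congˡ (homo n (f ∘ suc) (g ∘ suc)))
      (solve 4 (λ a b c d → a :+ b :+ (c :+ d) := a :+ c :+ (b :+ d)) refl _ _ _ _)
    scale : ∀ n k f → ∑ n (λ x → k * f x) ≈ k * ∑ n f
    scale zero    k f = sym (zeroʳ k)
    scale (suc n) k f = trans (+-congˡ (scale n k (f ∘ suc))) (sym (distribˡ _ _ _))

  module ∑ n = Summation (Summation-∑ n)

  ∑-swap : ∀ {X A} → Summation {X} A → ∀ n (f : X → Fin n → Carrier) →
    A (λ x → ∑ n (f x)) ≈ ∑ n (λ i → A (λ x → f x i))
  ∑-swap A zero    f = Summation.0-homo A (λ _ → refl)
  ∑-swap A (suc n) f = trans (Summation.+-homo A _ _) (+-congˡ (∑-swap A n (λ x → f x ∘ suc)))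

  ∑-permute : ∀ n f (π : Permutation′ n) → ∑ n f ≈ ∑ n (λ i → f (π ⟨$⟩ʳ i))
  ∑-permute n f π = begin
    ∑ n f                        ≈⟨ ∑≈sum n f ⟩
    sum f                        ≈⟨ sum-permute f π ⟩
    sum (λ i → f (π ⟨$⟩ʳ i))     ≈⟨ ∑≈sum n _ ⟨
    ∑ n (λ i → f (π ⟨$⟩ʳ i))     ∎
    where
    ∑≈sum : ∀ n f → ∑ n f ≈ sum f
    ∑≈sum zero    f = refl
    ∑≈sum (suc n) f = +-congˡ (∑≈sum n (f ∘ suc))

  ∑-single : ∀ n f j → (∀ i → i ≢ j → f i ≈ 0#) → ∑ n f ≈ f j
  ∑-single (suc n) f zero    f≈0 =
    trans (+-congˡ (∑.0-homo n λ i → f≈0 (suc i) λ ())) (+-identityʳ _)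
  ∑-single (suc n) f (suc j) f≈0 =
    trans (+-cong (f≈0 zero λ ()) (∑-single n (f ∘ suc) j λ i i≢j → f≈0 (suc i) (i≢j ∘ suc-injective)))
      (+-identityˡ _)

  ∏-cong : ∀ n {f g} → (∀ i → f i ≈ g i) → ∏ n f ≈ ∏ n g
  ∏-cong zero    eq = refl
  ∏-cong (suc n) eq = *-cong (eq zero) (∏-cong n (eq ∘ suc))

  ∏-zero : ∀ n {f} → 1 ≤ n → (∀ i → f i ≈ 0#) → ∏ n f ≈ 0#
  ∏-zero (suc n) _ eq = trans (*-congʳ (eq zero)) (zeroˡ _)

-- The finite subfield: arithmetic on indices and the permutations it induces.

module SubfieldProperties {c ℓ} (F : Field c ℓ) {q : ℕ} (K : FiniteSubfield F q) where
  open Field F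
  open FiniteSubfield K
  open FieldProperties F
  open IntegerCoefficients commutativeRing
  open import Algebra.Properties.Group +-group using (∙-cancelˡ)
  open import Algebra.Properties.Ring ring using (-0#≈0#)
  open import Relation.Binary.Reasoning.Setoid setoid

  0ᵏ : Fin q
  0ᵏ = zeroIdx

  _+ᵏ_ _*ᵏ_ : Fin q → Fin q → Fin q
  i +ᵏ j = proj₁ (+-closed i j)
  i *ᵏ j = proj₁ (*-closed i j)

  -ᵏ_ : Fin q → Fin q
  -ᵏ i = proj₁ (neg-closed i)

  e-+ : ∀ i j → e (i +ᵏ j) ≈ e i + e j
  e-+ i j = proj₂ (+-closed i j)

  e-* : ∀ i j → e (i *ᵏ j) ≈ e i * e j
  e-* i j = proj₂ (*-closed i j)

  e-neg : ∀ i → e (-ᵏ i) ≈ - e i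
  e-neg i = proj₂ (neg-closed i)

  e≉0 : ∀ {i} → i ≢ 0ᵏ → ¬ e i ≈ 0#
  e≉0 i≢0 ei≈0 = i≢0 (e-inj _ _ (trans ei≈0 (sym e-zero)))

  +ᵏ-comm : ∀ i j → i +ᵏ j ≡ j +ᵏ i
  +ᵏ-comm i j = e-inj _ _ (trans (e-+ i j) (trans (+-comm _ _) (sym (e-+ j i))))

  +ᵏ-identityˡ : ∀ i → 0ᵏ +ᵏ i ≡ i
  +ᵏ-identityˡ i = e-inj _ _ (trans (e-+ 0ᵏ i) (trans (+-congʳ e-zero) (+-identityˡ _)))

  *ᵏ-zeroʳ : ∀ i → i *ᵏ 0ᵏ ≡ 0ᵏ
  *ᵏ-zeroʳ i = e-inj _ _ (trans (e-* i 0ᵏ) (trans (*-congˡ e-zero) (trans (zeroʳ _) (sym e-zero))))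

  translation : Fin q → Permutation′ q
  translation j = permutation (_+ᵏ j) (_+ᵏ (-ᵏ j))
    (λ i → e-inj _ _ (begin
      e ((i +ᵏ (-ᵏ j)) +ᵏ j)  ≈⟨ trans (e-+ _ _) (+-congʳ (trans (e-+ _ _) (+-congˡ (e-neg j)))) ⟩
      e i - e j + e j         ≈⟨ solve 2 (λ x y → x :- y :+ y := x) refl _ _ ⟩
      e i                     ∎))
    (λ i → e-inj _ _ (begin
      e ((i +ᵏ j) +ᵏ (-ᵏ j))  ≈⟨ trans (e-+ _ _) (+-cong (e-+ _ _) (e-neg j)) ⟩
      e i + e j - e j         ≈⟨ solve 2 (λ x y → x :+ y :- y := x) refl _ _ ⟩
      e i                     ∎))

  scaling : ∀ j → j ≢ 0ᵏ → Permutation′ q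
  scaling j j≢0 = permutation (j *ᵏ_) (k *ᵏ_)
    (λ i → e-inj _ _ (begin
      e (j *ᵏ (k *ᵏ i))    ≈⟨ trans (e-* _ _) (*-congˡ (trans (e-* _ _) (*-congʳ ek))) ⟩
      e j * (e j ⁻¹ * e i) ≈⟨ *-assoc _ _ _ ⟨
      e j * e j ⁻¹ * e i   ≈⟨ cancel i ⟩
      e i                  ∎))
    (λ i → e-inj _ _ (begin
      e (k *ᵏ (j *ᵏ i))    ≈⟨ trans (e-* _ _) (*-cong ek (e-* _ _)) ⟩
      e j ⁻¹ * (e j * e i) ≈⟨ trans (*-congʳ (*-comm _ _)) (*-assoc _ _ _) ⟨
      e j * e j ⁻¹ * e i   ≈⟨ cancel i ⟩
      e i                  ∎))
    where
    k = proj₁ (inv-closed j (e≉0 j≢0))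
    ek = proj₂ (inv-closed j (e≉0 j≢0))
    cancel : ∀ i → e j * e j ⁻¹ * e i ≈ e i
    cancel i = trans (*-congʳ (⁻¹-inverse _ (e≉0 j≢0))) (*-identityˡ _)

  -- Adding 1 permutes the subfield, so the sum of all its elements does not change when 1 is added
  -- to each of them.
  ∑1≈0 : ∑ q (λ _ → 1#) ≈ 0#
  ∑1≈0 = ∙-cancelˡ (∑ q e) _ _ (begin
    ∑ q e + ∑ q (λ _ → 1#)             ≈⟨ ∑.+-homo q e (λ _ → 1#) ⟨
    ∑ q (λ i → e i + 1#)               ≈⟨ ∑.cong q (λ i → trans (e-+ i oneIdx) (+-congˡ e-one)) ⟨
    ∑ q (λ i → e (i +ᵏ oneIdx))        ≈⟨ ∑-permute q e (translation oneIdx) ⟨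
    ∑ q e                              ≈⟨ +-identityʳ _ ⟨
    ∑ q e + 0#                         ∎)

  ∑-const : ∀ x → ∑ q (λ _ → x) ≈ 0#
  ∑-const x = begin
    ∑ q (λ _ → x)        ≈⟨ ∑.cong q (λ _ → *-identityʳ x) ⟨
    ∑ q (λ _ → x * 1#)   ≈⟨ ∑.*-homoˡ q x _ ⟩
    x * ∑ q (λ _ → 1#)   ≈⟨ trans (*-congˡ ∑1≈0) (zeroʳ x) ⟩
    0#                   ∎

  -- There are q - 1 = -1 nonzero scalars.
  ∑-const-off-zero : ∀ f x → (∀ i → i ≢ 0ᵏ → f i ≈ x) → ∑ q f ≈ f 0ᵏ - x
  ∑-const-off-zero f x f≈x = begin
    ∑ q f                        ≈⟨ +-identityʳ _ ⟨
    ∑ q f + 0#                   ≈⟨ +-congˡ -0#≈0# ⟨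
    ∑ q f - 0#                   ≈⟨ +-congˡ (-‿cong (∑-const x)) ⟨
    ∑ q f - ∑ q (λ _ → x)        ≈⟨ ∑.sub-homo q f (λ _ → x) ⟨
    ∑ q (λ i → f i - x)          ≈⟨ ∑-single q _ 0ᵏ (λ i i≢0 → trans (+-congʳ (f≈x i i≢0)) (-‿inverseʳ x)) ⟩
    f 0ᵏ - x                     ∎

  -- Power sums over the finite subfield.

  powerSum : ℕ → Carrier
  powerSum n = ∑ q (λ i → e i ^ n)

  -- Powers on indices, whose equality is decidable; this is what lets `∃-non-fixed` search for a
  -- witness.
  _^ᵏ_ : Fin q → ℕ → Fin q
  i ^ᵏ zero  = oneIdx
  i ^ᵏ suc n = i *ᵏ (i ^ᵏ n)

  e-^ : ∀ i n → e (i ^ᵏ n) ≈ e i ^ n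
  e-^ i zero    = e-one
  e-^ i (suc n) = trans (e-* _ _) (*-congˡ (e-^ i n))

  -- Otherwise all `q` elements would be roots of the monic polynomial x^(n+2) - x, whose degree is
  -- below `q`.
  ∃-non-fixed : ∀ n → suc (suc n) < q → ∃ λ i → ¬ (e i ^ suc (suc n) ≈ e i)
  ∃-non-fixed n 2+n<q = ¬∀⟶∃¬ q (λ i → e i ^ suc (suc n) ≈ e i)
    (λ i → map′ (λ eq → trans (sym (e-^ i (suc (suc n)))) (reflexive (≡.cong e eq)))
                (λ eq → e-inj _ _ (trans (e-^ i (suc (suc n))) eq))
                ((i ^ᵏ suc (suc n)) ≟ i))
    λ fixed → Horner.too-many-roots (suc (suc n)) (0# ∷ - 1# ∷ replicate n 0#) point
      (λ i j eq → inject≤-injective 2+n<q 2+n<q i j (e-inj _ _ eq))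
      λ i → trans (Horner.eval-x^[2+n]-x n (point i))
        (trans (+-congʳ (fixed _)) (-‿inverseʳ _))
    where
    -- The first n + 3 elements of the subfield, one more than the degree.
    point : Fin (suc (suc (suc n))) → Carrier
    point i = e (inject≤ i 2+n<q)

  -- Multiplication by a nonzero `e j` permutes the subfield, so `e j ^ n` fixes the power sum. The
  -- extra factor `e j` on both sides makes the equation hold at `j = 0ᵏ` too.
  powerSum-scale : ∀ j n → e j ^ suc n * powerSum n ≈ e j * powerSum n
  powerSum-scale j n with j ≟ 0ᵏ
  ... | yes ≡.refl = *-congʳ (trans (0^n≈0 {n = suc n} (s≤s z≤n) e-zero) (sym e-zero))
  ... | no j≢0 = begin
    e j * e j ^ n * powerSum n                ≈⟨ *-assoc _ _ _ ⟩
    e j * (e j ^ n * powerSum n)              ≈⟨ *-congˡ (∑.*-homoˡ q _ _) ⟨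
    e j * ∑ q (λ i → e j ^ n * e i ^ n)       ≈⟨ *-congˡ (∑.cong q λ i → trans (^-cong n (e-* j i)) (^-distrib-* _ _ n)) ⟨
    e j * ∑ q (λ i → e (j *ᵏ i) ^ n)          ≈⟨ *-congˡ (∑-permute q (λ i → e i ^ n) (scaling j j≢0)) ⟨
    e j * powerSum n                          ∎

  -- For a positive exponent, an element that is not fixed by the next power gives a nonzero factor
  -- which, by `powerSum-scale`, annihilates the power sum.
  powerSum≈0 : ∀ n → suc n < q → powerSum n ≈ 0#
  powerSum≈0 zero    _ = ∑1≈0
  powerSum≈0 (suc n) 2+n<q = x*y≈0⇒y≈0
    {e j ^ suc (suc n) - e j} (not-fixed ∘ x-y≈0⇒x≈y _ _) (begin
      (e j ^ suc (suc n) - e j) * powerSum (suc n)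
        ≈⟨ solve 3 (λ a b s → (a :- b) :* s := a :* s :- b :* s)
             refl (e j ^ suc (suc n)) (e j) (powerSum (suc n)) ⟩
      e j ^ suc (suc n) * powerSum (suc n) - e j * powerSum (suc n)
        ≈⟨ +-congʳ (powerSum-scale j (suc n)) ⟩
      e j * powerSum (suc n) - e j * powerSum (suc n)
        ≈⟨ -‿inverseʳ _ ⟩
      0# ∎)
    where
    j = proj₁ (∃-non-fixed n 2+n<q)
    not-fixed = proj₂ (∃-non-fixed n 2+n<q)

  -- Each of the q - 1 nonzero scalars contributes `x`, and the zero scalar contributes nothing
  -- because `n` is positive.
  ∑-powers-fixing : ∀ n x → 1 ≤ n → (∀ i → i ≢ 0ᵏ → e i ^ n * x ≈ x) → powerSum n * x ≈ - x
  ∑-powers-fixing n x 1≤n fixes = begin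
    powerSum n * x               ≈⟨ ∑.*-homoʳ q x _ ⟨
    ∑ q (λ i → e i ^ n * x)      ≈⟨ ∑-const-off-zero _ x fixes ⟩
    e 0ᵏ ^ n * x - x             ≈⟨ +-congʳ (trans (*-congʳ (0^n≈0 1≤n e-zero)) (zeroˡ x)) ⟩
    0# - x                       ≈⟨ +-identityˡ _ ⟩
    - x                          ∎

  -- The same sum over all scalars is `- x` by `∑-powers-fixing` and 0 because the power sum
  -- vanishes. This kills sums whose degree is nonzero modulo q - 1.
  fixed-by-powers⇒0 : ∀ n x → 1 ≤ n → suc n < q → (∀ i → i ≢ 0ᵏ → e i ^ n * x ≈ x) → x ≈ 0#
  fixed-by-powers⇒0 n x 1≤n 1+n<q fixes = begin
    x                     ≈⟨ solve 1 (λ a → a := :- (:- a)) refl x ⟩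
    - - x                 ≈⟨ -‿cong (∑-powers-fixing n x 1≤n fixes) ⟨
    - (powerSum n * x)    ≈⟨ -‿cong (*-congʳ (powerSum≈0 n 1+n<q)) ⟩
    - (0# * x)            ≈⟨ trans (-‿cong (zeroˡ x)) -0#≈0# ⟩
    0#                    ∎

  -- Only the top coefficient in λ survives, since the power sums below
  -- q - 1 vanish.
  ∑-product-of-affine : ∀ n k (a c : Fin n → Carrier) → k ℕ.+ n < q →
    ∑ q (λ i → e i ^ k * ∏ n (λ j → a j + e i * c j)) ≈ powerSum (k ℕ.+ n) * ∏ n c
  ∑-product-of-affine zero k a c k+0<q = trans (∑.*-homoʳ q 1# _)
    (*-congʳ (reflexive (≡.cong powerSum (≡.sym (ℕₚ.+-identityʳ k)))))
  ∑-product-of-affine (suc n) k a c k+1+n<q = begin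
    ∑ q (λ i → e i ^ k * ((a₀ + e i * c₀) * Π i))
      -- Expanding the first factor either drops a power of `e i` or raises `k` by one, which is why
      -- the statement carries the exponent `k`.
      ≈⟨ ∑.cong q (λ i → solve 5 (λ p a x c t → p :* ((a :+ x :* c) :* t) := a :* (p :* t) :+ c :* (x :* p :* t))
           refl (e i ^ k) a₀ (e i) c₀ (Π i)) ⟩
    ∑ q (λ i → a₀ * (e i ^ k * Π i) + c₀ * (e i ^ suc k * Π i))
      ≈⟨ trans (∑.+-homo q _ _) (+-cong (∑.*-homoˡ q a₀ _) (∑.*-homoˡ q c₀ _)) ⟩
    a₀ * ∑ q (λ i → e i ^ k * Π i) + c₀ * ∑ q (λ i → e i ^ suc k * Π i)
      ≈⟨ +-cong (*-congˡ (∑-product-of-affine n k (a ∘ suc) (c ∘ suc) (ℕₚ.<⇒≤ 1+k+n<q)))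
                (*-congˡ (∑-product-of-affine n (suc k) (a ∘ suc) (c ∘ suc) 1+k+n<q)) ⟩
    a₀ * (powerSum (k ℕ.+ n) * ∏ n (c ∘ suc)) + c₀ * (powerSum (suc k ℕ.+ n) * ∏ n (c ∘ suc))
      ≈⟨ +-congʳ (trans (*-congˡ (trans (*-congʳ (powerSum≈0 _ 1+k+n<q)) (zeroˡ _))) (zeroʳ a₀)) ⟩
    0# + c₀ * (powerSum (suc k ℕ.+ n) * ∏ n (c ∘ suc))
      ≈⟨ +-identityˡ _ ⟩
    c₀ * (powerSum (suc k ℕ.+ n) * ∏ n (c ∘ suc))
      ≈⟨ solve 3 (λ c s t → c :* (s :* t) := s :* (c :* t))
             refl c₀ (powerSum (suc k ℕ.+ n)) (∏ n (c ∘ suc)) ⟩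
    powerSum (suc k ℕ.+ n) * (c₀ * ∏ n (c ∘ suc))
      ≈⟨ *-congʳ (reflexive (≡.cong powerSum (≡.sym (ℕₚ.+-suc k n)))) ⟩
    powerSum (k ℕ.+ suc n) * ∏ (suc n) c ∎
    where
    a₀ = a zero
    c₀ = c zero
    Π : Fin q → Carrier
    Π i = ∏ n (λ j → a (suc j) + e i * c (suc j))
    1+k+n<q : suc k ℕ.+ n < q
    1+k+n<q = ≡.subst (_< q) (ℕₚ.+-suc k n) k+1+n<q

-- Sums over coordinate vectors and their invariance under translation and scaling.

module VectorSums {c ℓ} (F : Field c ℓ) {q : ℕ} (K : FiniteSubfield F q) where
  open Field F
  open FiniteSubfield K
  open FqVectors F K
  open FieldProperties F
  open SubfieldProperties F K
  open IntegerCoefficients commutativeRing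
  open import Relation.Binary.Reasoning.Setoid setoid

  V : ℕ → Set
  V d = Vec (Fin q) d

  0ⱽ : ∀ {d} → V d
  0ⱽ = replicate _ 0ᵏ

  _⊕_ : ∀ {d} → V d → V d → V d
  _⊕_ = zipWith _+ᵏ_

  _·_ : ∀ {d} → Fin q → V d → V d
  i · v = map (i *ᵏ_) v

  zero-or-nonzero : ∀ {d} (v : V d) → v ≡ 0ⱽ ⊎ v ≢ 0ⱽ
  zero-or-nonzero v = fromDec (Vec-≡-dec _≟_ v 0ⱽ)
    where
    fromDec : ∀ {A : Set} → Dec A → A ⊎ ¬ A
    fromDec (yes a) = inj₁ a
    fromDec (no ¬a) = inj₂ ¬a

  ⊕-identityˡ : ∀ {d} (v : V d) → 0ⱽ ⊕ v ≡ v
  ⊕-identityˡ = zipWith-identityˡ +ᵏ-identityˡ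

  ⊕-comm : ∀ {d} (v w : V d) → v ⊕ w ≡ w ⊕ v
  ⊕-comm = zipWith-comm +ᵏ-comm

  ·-zeroʳ : ∀ {d} i → i · 0ⱽ {d} ≡ 0ⱽ
  ·-zeroʳ {d} i = ≡.trans (map-replicate (i *ᵏ_) 0ᵏ d) (≡.cong (replicate d) (*ᵏ-zeroʳ i))

  -- Vectors rather than functions Fin d → Fin q, so that every summand
  -- respects equality of its argument.
  ∑ⱽ : ∀ d → (V d → Carrier) → Carrier
  ∑ⱽ zero    g = g []
  ∑ⱽ (suc d) g = ∑ q (λ i → ∑ⱽ d (λ v → g (i ∷ v)))

  Summation-∑ⱽ : ∀ d → Summation (∑ⱽ d)
  Summation-∑ⱽ d = record { cong = cong d ; +-homo = homo d ; *-homoˡ = scale d }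
    where
    cong : ∀ d {f g} → (∀ v → f v ≈ g v) → ∑ⱽ d f ≈ ∑ⱽ d g
    cong zero    eq = eq []
    cong (suc d) eq = ∑.cong q λ i → cong d λ v → eq (i ∷ v)
    homo : ∀ d f g → ∑ⱽ d (λ v → f v + g v) ≈ ∑ⱽ d f + ∑ⱽ d g
    homo zero    f g = refl
    homo (suc d) f g = trans (∑.cong q λ i → homo d _ _) (∑.+-homo q _ _)
    scale : ∀ d k f → ∑ⱽ d (λ v → k * f v) ≈ k * ∑ⱽ d f
    scale zero    k f = refl
    scale (suc d) k f = trans (∑.cong q λ i → scale d k _) (∑.*-homoˡ q k _)

  module ∑ⱽ d = Summation (Summation-∑ⱽ d)

  ∑ⱽ-swap : ∀ {X A} → Summation {X} A → ∀ d (f : X → V d → Carrier) →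
    A (λ x → ∑ⱽ d (f x)) ≈ ∑ⱽ d (λ v → A (λ x → f x v))
  ∑ⱽ-swap A zero    f = refl
  ∑ⱽ-swap A (suc d) f = trans (∑-swap A q _) (∑.cong q λ i → ∑ⱽ-swap A d _)

  ∑ⱽ-translate : ∀ {d} g (w : V d) → ∑ⱽ d (λ v → g (v ⊕ w)) ≈ ∑ⱽ d g
  ∑ⱽ-translate g []      = refl
  ∑ⱽ-translate g (j ∷ w) = trans
    (∑.cong q λ i → ∑ⱽ-translate (λ v → g ((i +ᵏ j) ∷ v)) w)
    (sym (∑-permute q (λ i → ∑ⱽ _ (λ v → g (i ∷ v))) (translation j)))

  ∑ⱽ-scale : ∀ {i} → i ≢ 0ᵏ → ∀ d g → ∑ⱽ d (λ v → g (i · v)) ≈ ∑ⱽ d g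
  ∑ⱽ-scale i≢0 zero    g = refl
  ∑ⱽ-scale {i} i≢0 (suc d) g = trans
    (∑.cong q λ j → ∑ⱽ-scale i≢0 d (λ v → g ((i *ᵏ j) ∷ v)))
    (sym (∑-permute q (λ j → ∑ⱽ d (λ v → g (j ∷ v))) (scaling i i≢0)))

  ∑ⱽ-single : ∀ d g → (∀ v → v ≢ 0ⱽ → g v ≈ 0#) → ∑ⱽ d g ≈ g 0ⱽ
  ∑ⱽ-single zero    g g≈0 = refl
  ∑ⱽ-single (suc d) g g≈0 = trans
    (∑-single q _ 0ᵏ λ i i≢0 → ∑ⱽ.0-homo d λ v → g≈0 (i ∷ v) (i≢0 ∘ ∷-injectiveˡ))
    (∑ⱽ-single d (λ v → g (0ᵏ ∷ v)) λ v v≢0 → g≈0 (0ᵏ ∷ v) (v≢0 ∘ ∷-injectiveʳ))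

  -- Pointwise agreement, so that no function extensionality is called for.
  _Represents_ : ∀ {d} → V d → (Fin d → Fin q) → Set
  v Represents θ = ∀ i → θ i ≡ lookup v i

  -- The hypothesis ranges over every `θ` representing `v`, because the functions built inside
  -- `∑all` are known only through their values.
  ∑all≈∑ⱽ : ∀ d f g → (∀ θ v → v Represents θ → f θ ≈ g v) → ∑all d f ≈ ∑ⱽ d g
  ∑all≈∑ⱽ zero    f g f≈g = f≈g _ [] λ ()
  ∑all≈∑ⱽ (suc d) f g f≈g = ∑.cong q λ i → ∑all≈∑ⱽ d _ _ λ θ v rep →
    f≈g _ (i ∷ v) λ { zero → ≡.refl ; (suc j) → rep j }

  -- With `g` zero at the origin, the sum over nonzero vectors becomes a full sum, to which
  -- translation and scaling apply.
  ∑nz≈∑ⱽ : ∀ d f g → g 0ⱽ ≈ 0# → (∀ θ v → v Represents θ → v ≢ 0ⱽ → f θ ≈ g v) →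
    ∑nz d f ≈ ∑ⱽ d g
  ∑nz≈∑ⱽ zero    f g g0≈0 f≈g = sym g0≈0
  ∑nz≈∑ⱽ (suc d) f g g0≈0 f≈g = ∑.cong q slice
    where
    summand : ∀ {h x} → x ≡ ∑ q h → Fin q → Carrier
    summand {h} _ = h
    -- Names the summand hidden in a where-block of ∑nz.
    slice : ∀ i → summand {x = ∑nz (suc d) f} ≡.refl i ≈ ∑ⱽ d (λ v → g (i ∷ v))
    slice i with i ≟ zeroIdx
    ... | yes ≡.refl = ∑nz≈∑ⱽ d _ _ g0≈0 λ θ v rep v≢0 →
      f≈g _ (i ∷ v) (λ { zero → ≡.refl ; (suc j) → rep j }) (v≢0 ∘ ∷-injectiveʳ)
    ... | no i≢0 = ∑all≈∑ⱽ d _ _ λ θ v rep →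
      f≈g _ (i ∷ v) (λ { zero → ≡.refl ; (suc j) → rep j }) (i≢0 ∘ ∷-injectiveˡ)

  -- Linear forms on coordinate vectors.

  record Linear {d} (φ : V d → Carrier) : Set ℓ where
    field
      +-homo : ∀ v w → φ (v ⊕ w) ≈ φ v + φ w
      ·-homo : ∀ i v → φ (i · v) ≈ e i * φ v
      0-homo : φ 0ⱽ ≈ 0#

  combination : ∀ {d} → (Fin d → Carrier) → V d → Carrier
  combination {d} b v = ∑ d (λ i → e (lookup v i) * b i)

  combination-linear : ∀ {d} (b : Fin d → Carrier) → Linear (combination b)
  combination-linear {d} b = record
    { +-homo = λ v w → trans
        (∑.cong d λ i → trans (*-congʳ (trans (lookup-e (lookup-zipWith _ i v w)) (e-+ _ _))) (distribʳ _ _ _))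
        (∑.+-homo d _ _)
    ; ·-homo = λ j v → trans
        (∑.cong d λ i → trans (*-congʳ (trans (lookup-e (lookup-map i _ v)) (e-* _ _))) (*-assoc _ _ _))
        (∑.*-homoˡ d _ _)
    ; 0-homo = ∑.0-homo d λ i →
        trans (*-congʳ (trans (lookup-e (lookup-replicate i 0ᵏ)) e-zero)) (zeroˡ _)
    }
    where
    lookup-e : ∀ {i j} → i ≡ j → e i ≈ e j
    lookup-e eq = reflexive (≡.cong e eq)

-- Sums weighted by powers of the reciprocal `ι` of a linear form `D`.

module PowerSums {c ℓ} (F : Field c ℓ) {q : ℕ} (K : FiniteSubfield F q) (d : ℕ)
  (D ι : Vec (Fin q) d → Field.Carrier F)
  (D-linear : VectorSums.Linear F K D)
  (ι-zero : Field._≈_ F (ι (VectorSums.0ⱽ F K)) (Field.0# F))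
  (ι-inverse : ∀ v → v ≢ VectorSums.0ⱽ F K → Field._≈_ F (Field._*_ F (D v) (ι v)) (Field.1# F))
  where
  open Field F
  open FiniteSubfield K
  open FieldProperties F
  open SubfieldProperties F K
  open VectorSums F K
  open IntegerCoefficients commutativeRing
  open import Algebra.Properties.Ring ring using (-1*x≈-x; -0#≈0#)
  open import Relation.Binary.Reasoning.Setoid setoid

  private
    module D = Linear D-linear
    module Σⱽ = Summation (Summation-∑ⱽ d)

    Σⱽ : (V d → Carrier) → Carrier
    Σⱽ = ∑ⱽ d

    Σⱽ² : (V d → V d → Carrier) → Carrier
    Σⱽ² h = Σⱽ λ u → Σⱽ λ v → h u v

    Σⱽ²-cong : ∀ {h h′} → (∀ u v → h u v ≈ h′ u v) → Σⱽ² h ≈ Σⱽ² h′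
    Σⱽ²-cong eq = Σⱽ.cong λ u → Σⱽ.cong (eq u)

    Σⱽ²-product : ∀ f g → Σⱽ² (λ u v → f u * g v) ≈ Σⱽ f * Σⱽ g
    Σⱽ²-product f g = trans (Σⱽ.cong λ u → Σⱽ.*-homoˡ (f u) g) (Σⱽ.*-homoʳ _ f)

    Σⱽ²-+ : ∀ h h′ → Σⱽ² (λ u v → h u v + h′ u v) ≈ Σⱽ² h + Σⱽ² h′
    Σⱽ²-+ h h′ = trans (Σⱽ.cong λ u → Σⱽ.+-homo _ _) (Σⱽ.+-homo _ _)

    Σⱽ²-sub : ∀ h h′ → Σⱽ² (λ u v → h u v - h′ u v) ≈ Σⱽ² h - Σⱽ² h′
    Σⱽ²-sub h h′ = trans (Σⱽ.cong λ u → Σⱽ.sub-homo _ _) (Σⱽ.sub-homo _ _)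

    Σⱽ²-swap : ∀ h → Σⱽ² h ≈ Σⱽ² (λ u v → h v u)
    Σⱽ²-swap h = ∑ⱽ-swap (Summation-∑ⱽ d) d h

  -- At the origin both sides vanish; elsewhere multiplication by `D v` turns both into 1. This is
  -- homogeneity of degree -1, written without an inverse of `e i`.
  ι-scale : ∀ {i} → i ≢ 0ᵏ → ∀ v → e i * ι (i · v) ≈ ι v
  ι-scale {i} i≢0 v = [ zero-case , nonzero-case ]′ (zero-or-nonzero v)
    where
    zero-case : v ≡ 0ⱽ → e i * ι (i · v) ≈ ι v
    zero-case ≡.refl = begin
      e i * ι (i · 0ⱽ)  ≈⟨ *-congˡ (trans (reflexive (≡.cong ι (·-zeroʳ i))) ι-zero) ⟩
      e i * 0#          ≈⟨ zeroʳ _ ⟩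
      0#                ≈⟨ ι-zero ⟨
      ι 0ⱽ              ∎
    nonzero-case : v ≢ 0ⱽ → e i * ι (i · v) ≈ ι v
    nonzero-case v≢0 = *-cancelˡ-≉0 Dv≉0 (begin
      D v * (e i * ι (i · v))   ≈⟨ solve 3 (λ x y z → x :* (y :* z) := y :* x :* z) refl _ _ _ ⟩
      e i * D v * ι (i · v)     ≈⟨ *-congʳ (D.·-homo i v) ⟨
      D (i · v) * ι (i · v)     ≈⟨ ι-inverse (i · v) iv≢0 ⟩
      1#                        ≈⟨ ι-inverse v v≢0 ⟨
      D v * ι v                 ∎)
      where
      Dv≉0 : ¬ D v ≈ 0#
      Dv≉0 = x*y≈1⇒x≉0 (ι-inverse v v≢0)
      iv≢0 : i · v ≢ 0ⱽ
      iv≢0 iv≡0 = Dv≉0 (x*y≈0⇒y≈0 (e≉0 i≢0) (begin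
        e i * D v   ≈⟨ D.·-homo i v ⟨
        D (i · v)   ≈⟨ reflexive (≡.cong D iv≡0) ⟩
        D 0ⱽ        ≈⟨ D.0-homo ⟩
        0#          ∎))

  -- As `ι` is zero at the origin, for n ≥ 1 this is the sum of g / D^n over the nonzero vectors.
  M : ℕ → (V d → Carrier) → Carrier
  M n g = Σⱽ (λ v → g v * ι v ^ n)

  Homogeneous : ℕ → (V d → Carrier) → Set ℓ
  Homogeneous r g = ∀ i v → g (i · v) ≈ e i ^ r * g v

  1-homogeneous : Homogeneous 0 (λ _ → 1#)
  1-homogeneous i v = sym (*-identityˡ 1#)

  linear-homogeneous : ∀ {ψ} → Linear ψ → Homogeneous 1 ψ
  linear-homogeneous ψ-linear i v =
    trans (Linear.·-homo ψ-linear i v) (*-congʳ (sym (*-identityʳ (e i))))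

  -- Replacing `v` by `i · v` permutes the summands. The substitution brings out `e i ^ r` from `g`
  -- and the inverse of `e i ^ (r + n)` from `ι`, so `e i ^ n` restores the sum.
  M-fixed : ∀ r n g → Homogeneous r g → ∀ i → i ≢ 0ᵏ → e i ^ n * M (r ℕ.+ n) g ≈ M (r ℕ.+ n) g
  M-fixed r n g g-hom i i≢0 = begin
    e i ^ n * M (r ℕ.+ n) g
      ≈⟨ *-congˡ (∑ⱽ-scale i≢0 d (λ v → g v * ι v ^ (r ℕ.+ n))) ⟨
    e i ^ n * Σⱽ (λ v → g (i · v) * ι (i · v) ^ (r ℕ.+ n))
      ≈⟨ Σⱽ.*-homoˡ _ _ ⟨
    Σⱽ (λ v → e i ^ n * (g (i · v) * ι (i · v) ^ (r ℕ.+ n)))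
      ≈⟨ Σⱽ.cong absorb ⟩
    M (r ℕ.+ n) g ∎
    where
    absorb : ∀ v → e i ^ n * (g (i · v) * ι (i · v) ^ (r ℕ.+ n)) ≈ g v * ι v ^ (r ℕ.+ n)
    absorb v = begin
      e i ^ n * (g (i · v) * ι (i · v) ^ (r ℕ.+ n))
        ≈⟨ *-congˡ (*-congʳ (g-hom i v)) ⟩
      e i ^ n * (e i ^ r * g v * ι (i · v) ^ (r ℕ.+ n))
        ≈⟨ solve 4 (λ x y z t → x :* (y :* z :* t) := z :* (y :* x :* t))
             refl (e i ^ n) (e i ^ r) (g v) (ι (i · v) ^ (r ℕ.+ n)) ⟩
      g v * (e i ^ r * e i ^ n * ι (i · v) ^ (r ℕ.+ n))
        ≈⟨ *-congˡ (*-congʳ (^-homo-+ (e i) r n)) ⟨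
      g v * (e i ^ (r ℕ.+ n) * ι (i · v) ^ (r ℕ.+ n))
        ≈⟨ *-congˡ (^-distrib-* (e i) (ι (i · v)) (r ℕ.+ n)) ⟨
      g v * (e i * ι (i · v)) ^ (r ℕ.+ n)
        ≈⟨ *-congˡ (^-cong (r ℕ.+ n) (ι-scale i≢0 v)) ⟩
      g v * ι v ^ (r ℕ.+ n) ∎

  M-vanishes : ∀ r n g → Homogeneous r g → 1 ≤ n → suc n < q → M (r ℕ.+ n) g ≈ 0#
  M-vanishes r n g g-hom 1≤n 1+n<q = fixed-by-powers⇒0 n _ 1≤n 1+n<q (M-fixed r n g g-hom)

  -- H n x y = ∑_{a+b=n+1, a,b≥1} xᵃ yᵇ
  H : ℕ → Carrier → Carrier → Carrier
  H zero    x y = 0#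
  H (suc n) x y = x * y ^ suc n + x * H n x y

  H-zeroʳ : ∀ n {x y} → y ≈ 0# → H n x y ≈ 0#
  H-zeroʳ zero    y≈0 = refl
  H-zeroʳ (suc n) y≈0 = trans
    (+-cong (trans (*-congˡ (0^n≈0 {n = suc n} (s≤s z≤n) y≈0)) (zeroʳ _)) (trans (*-congˡ (H-zeroʳ n y≈0)) (zeroʳ _)))
    (+-identityˡ 0#)

  -- The sum telescopes. Stating it with the factor `y - x` avoids division and keeps it valid for
  -- equal arguments.
  H-geometric : ∀ n x y → (y - x) * H n x y ≈ x * y * (y ^ n - x ^ n)
  H-geometric zero x y = begin
    (y - x) * 0#        ≈⟨ zeroʳ _ ⟩
    0#                  ≈⟨ zeroʳ _ ⟨
    x * y * 0#          ≈⟨ *-congˡ (-‿inverseʳ 1#) ⟨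
    x * y * (1# - 1#)   ∎
  H-geometric (suc n) x y = begin
    (y - x) * (x * y ^ suc n + x * H n x y)
      ≈⟨ solve 4 (λ x y p h → (y :- x) :* (x :* p :+ x :* h) := (y :- x) :* (x :* p) :+ x :* ((y :- x) :* h))
           refl x y (y ^ suc n) (H n x y) ⟩
    (y - x) * (x * y ^ suc n) + x * ((y - x) * H n x y)
      ≈⟨ +-congˡ (*-congˡ (H-geometric n x y)) ⟩
    (y - x) * (x * (y * y ^ n)) + x * (x * y * (y ^ n - x ^ n))
      ≈⟨ solve 4 (λ x y p r → (y :- x) :* (x :* (y :* p)) :+ x :* (x :* y :* (p :- r))
                            := x :* y :* (y :* p :- x :* r))
           refl x y (y ^ n) (x ^ n) ⟩
    x * y * (y ^ suc n - x ^ suc n) ∎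

  -- Expanding `H`, this is the sum of `M a f * M b g` over a + b = n + 1 with a, b ≥ 1.
  X : ℕ → (V d → Carrier) → (V d → Carrier) → Carrier
  X n f g = Σⱽ² λ u v → f u * g v * H n (ι u) (ι v)

  -- The term with a = 1 is split off; in the others one factor `ι u` is absorbed into `f`, so
  -- inductions on `n` keep `g` fixed and vary `f`.
  X-suc : ∀ n f g → X (suc n) f g ≈ Σⱽ (λ u → f u * ι u) * M (suc n) g + X n (λ u → f u * ι u) g
  X-suc n f g = begin
    X (suc n) f g
      ≈⟨ Σⱽ²-cong (λ u v → solve 5
           (λ a b x p h → a :* b :* (x :* p :+ x :* h) := a :* x :* (b :* p) :+ a :* x :* b :* h)
           refl (f u) (g v) (ι u) (ι v ^ suc n) (H n (ι u) (ι v))) ⟩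
    Σⱽ² (λ u v → f u * ι u * (g v * ι v ^ suc n) + f u * ι u * g v * H n (ι u) (ι v))
      ≈⟨ Σⱽ²-+ _ _ ⟩
    Σⱽ² (λ u v → f u * ι u * (g v * ι v ^ suc n)) + X n (λ u → f u * ι u) g
      ≈⟨ +-congʳ (Σⱽ²-product _ _) ⟩
    Σⱽ (λ u → f u * ι u) * M (suc n) g + X n (λ u → f u * ι u) g ∎

  X-vanishes : ∀ n f g → (∀ m → 1 ≤ m → m ≤ n → M m g ≈ 0#) → X n f g ≈ 0#
  X-vanishes zero    f g M≈0 = Σⱽ.0-homo λ u → Σⱽ.0-homo λ v → zeroʳ _
  X-vanishes (suc n) f g M≈0 = begin
    X (suc n) f g
      ≈⟨ X-suc n f g ⟩
    Σⱽ (λ u → f u * ι u) * M (suc n) g + X n (λ u → f u * ι u) g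
      ≈⟨ +-cong (trans (*-congˡ (M≈0 (suc n) (s≤s z≤n) ℕₚ.≤-refl)) (zeroʳ _))
                (X-vanishes n _ g λ m 1≤m m≤n → M≈0 m 1≤m (ℕₚ.m≤n⇒m≤1+n m≤n)) ⟩
    0# + 0#
      ≈⟨ +-identityˡ 0# ⟩
    0# ∎

  -- Only the term with a = 1 and b = n + 1 survives.
  X-first : ∀ n f g → (∀ m → 1 ≤ m → m ≤ n → M m g ≈ 0#) →
    X (suc n) f g ≈ Σⱽ (λ u → f u * ι u) * M (suc n) g
  X-first n f g M≈0 = trans (X-suc n f g)
    (trans (+-congˡ (X-vanishes n _ g M≈0)) (+-identityʳ _))

  -- Only the term with b = 1 survives, as the hypothesis covers 2 ≤ b ≤ n + 1.
  X-last : ∀ n f g → (∀ m → 1 ≤ m → m ≤ n → M (suc m) g ≈ 0#) →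
    X (suc n) f g ≈ M (suc n) f * M 1 g
  X-last zero f g M≈0 = trans (X-first zero f g λ { _ (s≤s _) () })
    (*-congʳ (Σⱽ.cong λ u → *-congˡ (sym (*-identityʳ (ι u)))))
  X-last (suc n) f g M≈0 = begin
    X (suc (suc n)) f g
      ≈⟨ X-suc (suc n) f g ⟩
    Σⱽ (λ u → f u * ι u) * M (suc (suc n)) g + X (suc n) (λ u → f u * ι u) g
      ≈⟨ +-cong (trans (*-congˡ (M≈0 (suc n) (s≤s z≤n) ℕₚ.≤-refl)) (zeroʳ _))
                (X-last n _ g λ m 1≤m m≤n → M≈0 m 1≤m (ℕₚ.m≤n⇒m≤1+n m≤n)) ⟩
    0# + M (suc n) (λ u → f u * ι u) * M 1 g
      ≈⟨ trans (+-identityˡ _) (*-congʳ (Σⱽ.cong λ u → *-assoc _ _ _)) ⟩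
    M (suc (suc n)) f * M 1 g ∎

  -- The inductive step: multiplying a product of s < q linear forms by one more form.

  module Step {s : ℕ} (1≤s : 1 ≤ s) (s<q : s < q)
    (φ : Fin s → V d → Carrier) (φ-linear : ∀ j → Linear (φ j))
    (ψ : V d → Carrier) (ψ-linear : Linear ψ)
    where

    private
      module ψ = Linear ψ-linear

    P k : V d → Carrier
    P v = ∏ s (λ j → φ j v)
    k v = ψ v * ι v

    -- The goal relates `Q * T` to `R`. The product `G * A` is an auxiliary term that cancels at the
    -- end through `S * A ≈ - A`.
    S T Q R A G : Carrier
    S = powerSum s
    T = M 1 ψ
    Q = M s P
    R = M (suc s) (λ v → P v * ψ v)
    A = M s (λ _ → 1#)
    G = Σⱽ (λ v → P v * ψ v * ι v)

    T≈Σk : Σⱽ k ≈ T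
    T≈Σk = Σⱽ.cong λ v → *-congˡ (sym (*-identityʳ (ι v)))

    P-zero : P 0ⱽ ≈ 0#
    P-zero = ∏-zero s 1≤s λ j → Linear.0-homo (φ-linear j)

    k-scale : ∀ {i} → i ≢ 0ᵏ → ∀ v → k (i · v) ≈ k v
    k-scale {i} i≢0 v = begin
      ψ (i · v) * ι (i · v)    ≈⟨ *-congʳ (ψ.·-homo i v) ⟩
      e i * ψ v * ι (i · v)    ≈⟨ solve 3 (λ x y z → x :* y :* z := y :* (x :* z)) refl (e i) (ψ v) (ι (i · v)) ⟩
      ψ v * (e i * ι (i · v))  ≈⟨ *-congˡ (ι-scale i≢0 v) ⟩
      ψ v * ι v                ∎

    -- Averaging over the line v + λw, using that k is invariant under w ↦ λw.
    shifted-sum : ∀ v → Σⱽ (λ w → k w * P (v ⊕ w)) ≈ P v * T - S * G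
    shifted-sum v = begin
      c₁                            ≈⟨ solve 2 (λ x y → y := x :- (x :- y)) refl (P v * T) c₁ ⟩
      P v * T - (P v * T - c₁)      ≈⟨ +-congˡ (-‿cong average) ⟨
      P v * T - S * G               ∎
      where
      c₁ = Σⱽ (λ w → k w * P (v ⊕ w))
      P-line : Fin q → V d → Carrier
      P-line i w = ∏ s (λ j → φ j v + e i * φ j w)
      P-line≈ : ∀ i w → P-line i w ≈ P (v ⊕ (i · w))
      P-line≈ i w = ∏-cong s λ j → sym (trans (Linear.+-homo (φ-linear j) v (i · w))
        (+-congˡ (Linear.·-homo (φ-linear j) i w)))
      off-zero : ∀ i → i ≢ 0ᵏ → Σⱽ (λ w → k w * P-line i w) ≈ c₁
      off-zero i i≢0 = trans
        (Σⱽ.cong λ w → *-cong (sym (k-scale i≢0 w)) (P-line≈ i w))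
        (∑ⱽ-scale i≢0 d (λ w → k w * P (v ⊕ w)))
      at-zero : Σⱽ (λ w → k w * P-line 0ᵏ w) ≈ P v * T
      at-zero = begin
        Σⱽ (λ w → k w * P-line 0ᵏ w)
          ≈⟨ Σⱽ.cong (λ w → *-congˡ (∏-cong s λ j →
               trans (+-congˡ (trans (*-congʳ e-zero) (zeroˡ _))) (+-identityʳ _))) ⟩
        Σⱽ (λ w → k w * P v)    ≈⟨ Σⱽ.*-homoʳ _ _ ⟩
        Σⱽ k * P v              ≈⟨ trans (*-comm _ _) (*-congˡ T≈Σk) ⟩
        P v * T                 ∎
      average : S * G ≈ P v * T - c₁
      average = begin
        S * G
          ≈⟨ Σⱽ.*-homoˡ S _ ⟨
        Σⱽ (λ w → S * (P w * ψ w * ι w))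
          ≈⟨ Σⱽ.cong (λ w → solve 4 (λ s p a b → s :* (p :* a :* b) := a :* b :* (s :* p)) refl S (P w) (ψ w) (ι w)) ⟩
        Σⱽ (λ w → k w * (S * P w))
          -- The top coefficient of P(v + λw) in λ is `P w`. The factor `S` is kept because it need
          -- not vanish when s = q - 1.
          ≈⟨ Σⱽ.cong (λ w → *-congˡ (∑-product-of-affine s 0 (λ j → φ j v) (λ j → φ j w) s<q)) ⟨
        Σⱽ (λ w → k w * ∑ q (λ i → 1# * P-line i w))
          ≈⟨ Σⱽ.cong (λ w → *-congˡ (∑.cong q λ i → *-identityˡ _)) ⟩
        Σⱽ (λ w → k w * ∑ q (λ i → P-line i w))
          ≈⟨ Σⱽ.cong (λ w → ∑.*-homoˡ q (k w) _) ⟨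
        Σⱽ (λ w → ∑ q (λ i → k w * P-line i w))
          ≈⟨ ∑-swap (Summation-∑ⱽ d) q _ ⟩
        ∑ q (λ i → Σⱽ (λ w → k w * P-line i w))
          ≈⟨ ∑-const-off-zero _ c₁ off-zero ⟩
        Σⱽ (λ w → k w * P-line 0ᵏ w) - c₁
          ≈⟨ +-congʳ at-zero ⟩
        P v * T - c₁ ∎

    -- As `ψ` has degree 1, `M b ψ` vanishes for 2 ≤ b ≤ s, which leaves b = 1.
    X-Pψ : X s P ψ ≈ Q * T
    X-Pψ = go s 1≤s s<q
      where
      go : ∀ n → 1 ≤ n → n < q → X n P ψ ≈ M n P * T
      go (suc n) _ 1+n<q = X-last n P ψ λ m 1≤m m≤n →
        M-vanishes 1 m ψ (linear-homogeneous ψ-linear) 1≤m (ℕₚ.≤-trans (s≤s (s≤s m≤n)) 1+n<q)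

    -- The constant 1 has degree 0, so only b = s is left; that term can be nonzero when s = q - 1.
    X-Pψ-1 : X s (λ v → P v * ψ v) (λ _ → 1#) ≈ G * A
    X-Pψ-1 = go s 1≤s s<q
      where
      go : ∀ n → 1 ≤ n → n < q → X n (λ v → P v * ψ v) (λ _ → 1#) ≈ G * M n (λ _ → 1#)
      go (suc n) _ 1+n<q = X-first n _ _ λ m 1≤m m≤n →
        M-vanishes 0 m _ 1-homogeneous 1≤m (ℕₚ.≤-trans (s≤s (s≤s m≤n)) 1+n<q)

    -- `split v w` is what `off-diagonal v (v ⊕ w)` becomes when `H` is replaced by
    -- `ι w * (ι v ^ s - ι (v ⊕ w) ^ s)`.
    off-diagonal split : V d → V d → Carrier
    off-diagonal v u = P u * (ψ v - ψ u) * H s (ι u) (ι v)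
    split v w = k w * (P (v ⊕ w) * ι (v ⊕ w) ^ s) - ι v ^ s * (k w * P (v ⊕ w))

    -- For nonzero `u` and `v`, `D w` is `D u * D v * (ι v - ι u)`, so `H-geometric` applies and the
    -- factors `D u * ι u` and `D v * ι v` become 1.
    ι-difference : ∀ u v w → u ≡ v ⊕ w → u ≢ 0ⱽ → v ≢ 0ⱽ →
      D w * H s (ι u) (ι v) ≈ ι v ^ s - ι u ^ s
    ι-difference u v w ≡.refl u≢0 v≢0 = begin
      D w * h
        ≈⟨ *-congʳ Dw ⟩
      D u * D v * (y - x) * h
        ≈⟨ trans (*-assoc _ _ _) (*-congˡ (H-geometric s x y)) ⟩
      D u * D v * (x * y * (y ^ s - x ^ s))
        ≈⟨ solve 5 (λ a b x y z → a :* b :* (x :* y :* z) := a :* x :* (b :* y :* z))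
             refl (D u) (D v) x y (y ^ s - x ^ s) ⟩
      D u * x * (D v * y * (y ^ s - x ^ s))
        ≈⟨ *-cong (ι-inverse u u≢0) (*-congʳ (ι-inverse v v≢0)) ⟩
      1# * (1# * (y ^ s - x ^ s))
        ≈⟨ trans (*-identityˡ _) (*-identityˡ _) ⟩
      y ^ s - x ^ s ∎
      where
      x = ι u
      y = ι v
      h = H s x y
      Dw : D w ≈ D u * D v * (y - x)
      Dw = begin
        D w
          ≈⟨ solve 2 (λ a b → b := a :+ b :- a) refl (D v) (D w) ⟩
        D v + D w - D v
          ≈⟨ +-congʳ (D.+-homo v w) ⟨
        D u - D v
          ≈⟨ +-cong (*-identityʳ _) (-‿cong (*-identityʳ _)) ⟨
        D u * 1# - D v * 1#
          ≈⟨ +-cong (*-congˡ (ι-inverse v v≢0)) (-‿cong (*-congˡ (ι-inverse u u≢0))) ⟨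
        D u * (D v * y) - D v * (D u * x)
          ≈⟨ solve 4 (λ a b x y → a :* (b :* y) :- b :* (a :* x) := a :* b :* (y :- x)) refl (D u) (D v) x y ⟩
        D u * D v * (y - x) ∎

    ψ-difference : ∀ v w → ψ v - ψ (v ⊕ w) ≈ - ψ w
    ψ-difference v w = trans (+-congˡ (-‿cong (ψ.+-homo v w)))
      (solve 2 (λ a b → a :- (a :+ b) := :- b) refl (ψ v) (ψ w))

    -- Both sides are multiples of `P u * ψ w`, which vanishes if `w` or `u` is the origin;
    -- otherwise `ι-difference` evaluates `H`.
    off-diagonal≈split : ∀ v w → v ≢ 0ⱽ → off-diagonal v (v ⊕ w) ≈ split v w
    off-diagonal≈split v w v≢0 =
      [ w-zero , (λ w≢0 → [ u-zero , generic w≢0 ]′ (zero-or-nonzero u)) ]′ (zero-or-nonzero w)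
      where
      u = v ⊕ w
      x = ι u
      y = ι v
      h = H s x y
      both-zero : P u * ψ w ≈ 0# → P u * (ψ v - ψ u) * h ≈ split v w
      both-zero Pψ≈0 = begin
        P u * (ψ v - ψ u) * h
          ≈⟨ *-congʳ (*-congˡ (ψ-difference v w)) ⟩
        P u * (- ψ w) * h
          ≈⟨ solve 3 (λ p a h → p :* (:- a) :* h := p :* a :* (:- h)) refl (P u) (ψ w) h ⟩
        P u * ψ w * (- h)
          ≈⟨ trans (*-congʳ Pψ≈0) (zeroˡ _) ⟩
        0#
          ≈⟨ trans (*-congʳ Pψ≈0) (zeroˡ _) ⟨
        P u * ψ w * (ι w * x ^ s - y ^ s * ι w)
          ≈⟨ solve 5 (λ p a i x y → p :* a :* (i :* x :- y :* i) := a :* i :* (p :* x) :- y :* (a :* i :* p))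
               refl (P u) (ψ w) (ι w) (x ^ s) (y ^ s) ⟩
        split v w ∎
      w-zero : w ≡ 0ⱽ → off-diagonal v u ≈ split v w
      w-zero w≡0 = both-zero (trans (*-congˡ (trans (reflexive (≡.cong ψ w≡0)) ψ.0-homo)) (zeroʳ _))
      u-zero : u ≡ 0ⱽ → off-diagonal v u ≈ split v w
      u-zero u≡0 = both-zero (trans (*-congʳ (trans (reflexive (≡.cong P u≡0)) P-zero)) (zeroˡ _))
      generic : w ≢ 0ⱽ → u ≢ 0ⱽ → off-diagonal v u ≈ split v w
      generic w≢0 u≢0 = begin
        P u * (ψ v - ψ u) * h
          ≈⟨ *-cong (*-congˡ (ψ-difference v w)) h≈ ⟩
        P u * (- ψ w) * (ι w * (y ^ s - x ^ s))
          ≈⟨ solve 5 (λ p a i x y → p :* (:- a) :* (i :* (y :- x)) := a :* i :* (p :* x) :- y :* (a :* i :* p))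
               refl (P u) (ψ w) (ι w) (x ^ s) (y ^ s) ⟩
        split v w ∎
        where
        h≈ : h ≈ ι w * (y ^ s - x ^ s)
        h≈ = begin
          h                       ≈⟨ *-identityˡ h ⟨
          1# * h                  ≈⟨ *-congʳ (ι-inverse w w≢0) ⟨
          D w * ι w * h           ≈⟨ solve 3 (λ a b c → a :* b :* c := b :* (a :* c)) refl (D w) (ι w) h ⟩
          ι w * (D w * h)         ≈⟨ *-congˡ (ι-difference u v w ≡.refl u≢0 v≢0) ⟩
          ι w * (y ^ s - x ^ s)   ∎

    -- At `v = 0ⱽ` both `H` and `ι v ^ s` vanish, so only the first half of `split` remains. Its sum
    -- over `w` is the correction `R`.
    off-diagonal-split-at-0 : ∀ w → off-diagonal 0ⱽ (0ⱽ ⊕ w) - split 0ⱽ w ≈ - (P w * ψ w * ι w ^ suc s)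
    off-diagonal-split-at-0 w = begin
      off-diagonal 0ⱽ (0ⱽ ⊕ w) - split 0ⱽ w
        ≈⟨ +-cong (trans (*-congˡ (H-zeroʳ s ι-zero)) (zeroʳ _)) (-‿cong split-at-0) ⟩
      0# - P w * ψ w * ι w ^ suc s
        ≈⟨ +-identityˡ _ ⟩
      - (P w * ψ w * ι w ^ suc s) ∎
      where
      split-at-0 : split 0ⱽ w ≈ P w * ψ w * ι w ^ suc s
      split-at-0 = begin
        split 0ⱽ w
          ≈⟨ reflexive (≡.cong (λ u → k w * (P u * ι u ^ s) - ι 0ⱽ ^ s * (k w * P u)) (⊕-identityˡ w)) ⟩
        k w * (P w * ι w ^ s) - ι 0ⱽ ^ s * (k w * P w)
          ≈⟨ +-congˡ (-‿cong (trans (*-congʳ (0^n≈0 1≤s ι-zero)) (zeroˡ _))) ⟩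
        k w * (P w * ι w ^ s) - 0#
          ≈⟨ trans (+-congˡ -0#≈0#) (+-identityʳ _) ⟩
        ψ w * ι w * (P w * ι w ^ s)
          ≈⟨ solve 4 (λ a i p x → a :* i :* (p :* x) := p :* a :* (i :* x)) refl (ψ w) (ι w) (P w) (ι w ^ s) ⟩
        P w * ψ w * ι w ^ suc s ∎

    -- In the first half `v ⊕ w` runs over all vectors for each fixed `w`, so the sum factors; the
    -- second half is `shifted-sum` weighted by `ι v ^ s`.
    sum-split : Σⱽ² split ≈ T * Q - (Q * T - A * (S * G))
    sum-split = trans (Σⱽ²-sub _ _) (+-cong first (-‿cong second))
      where
      first : Σⱽ² (λ v w → k w * (P (v ⊕ w) * ι (v ⊕ w) ^ s)) ≈ T * Q
      first = begin
        Σⱽ² (λ v w → k w * (P (v ⊕ w) * ι (v ⊕ w) ^ s))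
          ≈⟨ Σⱽ²-swap _ ⟩
        Σⱽ² (λ w v → k w * (P (v ⊕ w) * ι (v ⊕ w) ^ s))
          ≈⟨ Σⱽ.cong (λ w → ∑ⱽ-translate (λ u → k w * (P u * ι u ^ s)) w) ⟩
        Σⱽ² (λ w u → k w * (P u * ι u ^ s))
          ≈⟨ Σⱽ²-product _ _ ⟩
        Σⱽ k * Q
          ≈⟨ *-congʳ T≈Σk ⟩
        T * Q ∎
      second : Σⱽ² (λ v w → ι v ^ s * (k w * P (v ⊕ w))) ≈ Q * T - A * (S * G)
      second = begin
        Σⱽ² (λ v w → ι v ^ s * (k w * P (v ⊕ w)))
          ≈⟨ Σⱽ.cong (λ v → trans (Σⱽ.*-homoˡ _ _) (*-congˡ (shifted-sum v))) ⟩
        Σⱽ (λ v → ι v ^ s * (P v * T - S * G))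
          ≈⟨ Σⱽ.cong (λ v → trans
               (solve 4 (λ i p t g → i :* (p :* t :- g) := p :* i :* t :- i :* g) refl (ι v ^ s) (P v) T (S * G))
               (+-congˡ (-‿cong (*-congʳ (sym (*-identityˡ _)))))) ⟩
        Σⱽ (λ v → P v * ι v ^ s * T - 1# * ι v ^ s * (S * G))
          ≈⟨ trans (Σⱽ.sub-homo _ _) (+-cong (Σⱽ.*-homoʳ _ _) (-‿cong (Σⱽ.*-homoʳ _ _))) ⟩
        Q * T - A * (S * G) ∎

    -- After the substitution `u = v ⊕ w`, the difference from `split` is supported at `v = 0ⱽ`.
    sum-off-diagonal : Σⱽ² off-diagonal ≈ Σⱽ² split - R
    sum-off-diagonal = begin
      Σⱽ² off-diagonal
        ≈⟨ Σⱽ.cong (λ v → trans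
             (Σⱽ.cong λ w → reflexive (≡.cong (off-diagonal v) (⊕-comm v w)))
             (∑ⱽ-translate (off-diagonal v) v)) ⟨
      Σⱽ² shifted
        ≈⟨ solve 2 (λ x y → x := y :+ (x :- y)) refl (Σⱽ² shifted) (Σⱽ² split) ⟩
      Σⱽ² split + (Σⱽ² shifted - Σⱽ² split)
        ≈⟨ +-congˡ (Σⱽ²-sub shifted split) ⟨
      Σⱽ² split + Σⱽ² (λ v w → shifted v w - split v w)
        ≈⟨ +-congˡ (∑ⱽ-single d _ λ v v≢0 → Σⱽ.0-homo λ w →
             trans (+-congʳ (off-diagonal≈split v w v≢0)) (-‿inverseʳ _)) ⟩
      Σⱽ² split + Σⱽ (λ w → shifted 0ⱽ w - split 0ⱽ w)
        ≈⟨ +-congˡ (trans (Σⱽ.cong off-diagonal-split-at-0) (Σⱽ.neg-homo _)) ⟩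
      Σⱽ² split - R ∎
      where
      shifted : V d → V d → Carrier
      shifted v w = off-diagonal v (v ⊕ w)

    -- Expanding `ψ v - ψ u` gives two double sums; in the second, `ψ u` joins `P u` and the
    -- constant 1 remains on the side of `v`.
    sum-off-diagonal≈X : Σⱽ² off-diagonal ≈ Q * T - G * A
    sum-off-diagonal≈X = begin
      Σⱽ² off-diagonal
        ≈⟨ Σⱽ²-swap off-diagonal ⟩
      Σⱽ² (λ u v → P u * (ψ v - ψ u) * H s (ι u) (ι v))
        ≈⟨ Σⱽ²-cong (λ u v → trans
             (solve 4 (λ p a b h → p :* (a :- b) :* h := p :* a :* h :- p :* b :* h)
               refl (P u) (ψ v) (ψ u) (H s (ι u) (ι v)))
             (+-congˡ (-‿cong (*-congʳ (sym (*-identityʳ _)))))) ⟩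
      Σⱽ² (λ u v → P u * ψ v * H s (ι u) (ι v) - P u * ψ u * 1# * H s (ι u) (ι v))
        ≈⟨ Σⱽ²-sub _ _ ⟩
      X s P ψ - X s (λ v → P v * ψ v) (λ _ → 1#)
        ≈⟨ +-cong X-Pψ (-‿cong X-Pψ-1) ⟩
      Q * T - G * A ∎

    -- Scaling by `e i ^ s` fixes `A` for nonzero `e i`. This treats s = q - 1 and smaller s alike.
    SA≈-A : S * A ≈ - A
    SA≈-A = ∑-powers-fixing s A 1≤s (M-fixed 0 s _ 1-homogeneous)

    -- The two evaluations of the off-diagonal sum are compared: `Q * T` cancels once, and
    -- `G * (S * A)` cancels `G * A`.
    QT≈-R : Q * T ≈ - R
    QT≈-R = begin
      Q * T
        ≈⟨ solve 2 (λ x y → x := x :- y :+ y) refl (Q * T) (G * A) ⟩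
      Q * T - G * A + G * A
        ≈⟨ +-congʳ (trans (sym sum-off-diagonal≈X) (trans sum-off-diagonal (+-congʳ sum-split))) ⟩
      T * Q - (Q * T - A * (S * G)) - R + G * A
        ≈⟨ solve 6 (λ t q a s g r → t :* q :- (q :* t :- a :* (s :* g)) :- r :+ g :* a := g :* (s :* a) :+ g :* a :- r)
             refl T Q A S G R ⟩
      G * (S * A) + G * A - R
        ≈⟨ +-congʳ (+-congʳ (*-congˡ SA≈-A)) ⟩
      G * (- A) + G * A - R
        ≈⟨ solve 3 (λ g a r → g :* (:- a) :+ g :* a :- r := :- r) refl G A R ⟩
      - R ∎

  -- Induction on the number of forms: the first form plays `ψ`, the product of the others plays
  -- `P`, and each step contributes one sign.
  product-of-sums : ∀ s → suc s ≤ q → (φ : Fin (suc s) → V d → Carrier) → (∀ j → Linear (φ j)) →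
    ∏ (suc s) (λ j → M 1 (φ j)) ≈ (- 1#) ^ s * M (suc s) (λ v → ∏ (suc s) (λ j → φ j v))
  product-of-sums zero _ φ φ-linear = begin
    M 1 (φ zero) * 1#                    ≈⟨ *-comm _ _ ⟩
    1# * M 1 (φ zero)                    ≈⟨ *-congˡ (Σⱽ.cong λ v → *-congʳ (*-identityʳ _)) ⟨
    1# * M 1 (λ v → φ zero v * 1#)       ∎
  product-of-sums (suc s) 2+s≤q φ φ-linear = begin
    T * ∏ (suc s) (λ j → M 1 (φ (suc j)))
      ≈⟨ *-congˡ (product-of-sums s (ℕₚ.<⇒≤ 2+s≤q) (φ ∘ suc) (φ-linear ∘ suc)) ⟩
    T * ((- 1#) ^ s * Q)
      ≈⟨ solve 3 (λ t a q → t :* (a :* q) := a :* (q :* t)) refl T ((- 1#) ^ s) Q ⟩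
    (- 1#) ^ s * (Q * T)
      ≈⟨ *-congˡ (trans QT≈-R (sym (-1*x≈-x R))) ⟩
    (- 1#) ^ s * (- 1# * R)
      ≈⟨ solve 3 (λ a o r → a :* (o :* r) := o :* a :* r) refl ((- 1#) ^ s) (- 1#) R ⟩
    (- 1#) ^ suc s * R
      ≈⟨ *-congˡ (Σⱽ.cong λ v → *-congʳ (*-comm _ _)) ⟩
    (- 1#) ^ suc s * M (suc (suc s)) (λ v → ∏ (suc (suc s)) (λ j → φ j v)) ∎
    -- `Step` is used with `suc s` forms in the product, and `2+s≤q` is literally `suc s < q`.
    where open Step (s≤s z≤n) 2+s≤q (φ ∘ suc) (φ-linear ∘ suc) (φ zero) (φ-linear zero)

-- The reciprocal of the denominator, from linear independence.

module ReciprocalOfCombination {c ℓ} (F : Field c ℓ) {q : ℕ} (K : FiniteSubfield F q)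
  (d : ℕ) (b : Fin d → Field.Carrier F) (b-indep : FqVectors.LinIndep F K d b) where
  open Field F
  open FiniteSubfield K
  open FieldProperties F
  open SubfieldProperties F K
  open VectorSums F K

  D : V d → Carrier
  D = combination b

  D≉0 : ∀ v → v ≢ 0ⱽ → ¬ D v ≈ 0#
  D≉0 v v≢0 Dv≈0 = v≢0 (all-zero v (b-indep (lookup v) Dv≈0))
    where
    all-zero : ∀ {n} (v : V n) → (∀ i → lookup v i ≡ 0ᵏ) → v ≡ 0ⱽ
    all-zero []      eq = ≡.refl
    all-zero (i ∷ v) eq = ≡.cong₂ _∷_ (eq zero) (all-zero v (eq ∘ suc))

  -- The value at the origin is set to 0, whatever `_⁻¹` gives there.
  ι : V d → Carrier
  ι v = [ (λ _ → 0#) , (λ _ → D v ⁻¹) ]′ (zero-or-nonzero v)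

  ι-zero : ι 0ⱽ ≈ 0#
  ι-zero with zero-or-nonzero {d} 0ⱽ
  ... | inj₁ _   = refl
  ... | inj₂ 0≢0 = ⊥-elim (0≢0 ≡.refl)

  ι-inverse : ∀ v → v ≢ 0ⱽ → D v * ι v ≈ 1#
  ι-inverse v v≢0 with zero-or-nonzero v
  ... | inj₁ v≡0 = ⊥-elim (v≢0 v≡0)
  ... | inj₂ _   = ⁻¹-inverse _ (D≉0 v v≢0)

  combination-represents : ∀ a θ v → v Represents θ →
    ∑ d (λ i → e (θ i) * a i) ≈ combination a v
  combination-represents a θ v rep = ∑.cong d λ i → *-congʳ (reflexive (≡.cong e (rep i)))

  -- Uniqueness of inverses settles both the passage from `θ` to `v` and the exchange of inverse and
  -- power.
  ι^-represents : ∀ n θ v → v Represents θ → v ≢ 0ⱽ →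
    (∑ d (λ i → e (θ i) * b i) ^ n) ⁻¹ ≈ ι v ^ n
  ι^-represents n θ v rep v≢0 = sym (⁻¹-unique (trans (sym (^-distrib-* _ _ n)) (trans
    (^-cong n (trans (*-congʳ (combination-represents b θ v rep)) (ι-inverse v v≢0))) (1^n≈1 n))))

  ι-represents : ∀ θ v → v Represents θ → v ≢ 0ⱽ →
    ∑ d (λ i → e (θ i) * b i) ⁻¹ ≈ ι v
  ι-represents θ v rep v≢0 = sym (⁻¹-unique
    (trans (*-congʳ (combination-represents b θ v rep)) (ι-inverse v v≢0)))

-- Transfer of the product formula from vectors to functions.

theorem2 : ∀ {c ℓ : Level} (q : ℕ) → IsPrimePower q →
    (F : Field c ℓ) (K : FiniteSubfield F q) →
    (d s : ℕ) → 1 ≤ d → 1 ≤ s → s ≤ q →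
    (b : Fin d → Field.Carrier F) → FqVectors.LinIndep F K d b →
    (B : Fin d → Fin s → Field.Carrier F) →
    let open Field F
        open FiniteSubfield K
        open FqVectors F K
        L : (Fin d → Fin q) → Fin s → Carrier
        L θ j = ∑ d (λ i → e (θ i) * B i j)
        D : (Fin d → Fin q) → Carrier
        D θ = ∑ d (λ i → e (θ i) * b i)
    in ∏ s (λ j → ∑nz d (λ θ → L θ j / D θ))
       ≈ ((- 1#) ^ (s ∸ 1)) * ∑nz d (λ θ → ∏ s (λ j → L θ j) / (D θ ^ s))
theorem2 q _ F K d (suc s) _ _ 1+s≤q b b-indep B = trans
  -- Each factor is written with `ι v ^ 1` to take the form `M 1 (φ j)`; its summand vanishes at the
  -- origin because `φ j` does.
  (∏-cong (suc s) λ j → ∑nz≈∑ⱽ d _ (λ v → φ j v * ι v ^ 1)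
    (trans (*-congʳ (Linear.0-homo (φ-linear j))) (zeroˡ _))
    λ θ v rep v≢0 → *-cong (combination-represents (λ i → B i j) θ v rep)
      (trans (ι-represents θ v rep v≢0) (sym (*-identityʳ _))))
  (trans (product-of-sums s 1+s≤q φ φ-linear)
    (*-congˡ (sym (∑nz≈∑ⱽ d _ (λ v → ∏ (suc s) (λ j → φ j v) * ι v ^ suc s)
      (trans (*-congʳ (∏-zero (suc s) (s≤s z≤n) λ j → Linear.0-homo (φ-linear j))) (zeroˡ _))
      λ θ v rep v≢0 → *-cong
        (∏-cong (suc s) λ j → combination-represents (λ i → B i j) θ v rep)
        (ι^-represents (suc s) θ v rep v≢0)))))
  where
  open Field F
  open FieldProperties F
  open VectorSums F K
  open ReciprocalOfCombination F K d b b-indep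
  open PowerSums F K d D ι (combination-linear b) ι-zero ι-inverse
  φ : Fin (suc s) → V d → Carrier
  φ j = combination (λ i → B i j)
  φ-linear : ∀ j → Linear (φ j)
  φ-linear j = combination-linear (λ i → B i j)
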